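{- Let $C_n$ be the cycle on $n$ vertices, where $n\geq 5$, and let $k,t$ be positive integers. If $2\leq k\leq 1+\lfloor \frac{n}{2}\rfloor$, then $\rho'(C_n^k)=2$. Moreover, when $t\leq \lfloor \frac{n}{2}\rfloor$, we have $\rho(C_n^t)=3$.
   Context: $G^k$ denotes the $k$-th Cartesian power of $G$: $G^1=G$ and $G^k=G\square G^{k-1}$, where $\square$ is the Cartesian product of graphs. A vertex (or edge) coloring of a graph is distinguishing if no automorphism other than the identity preserves it. $D(G)$ (resp. $D'(G)$) is the least number of colors in a distinguishing vertex (resp. edge) coloring of $G$. When $D(G)=2$, the cost of distinguishing $\rho(G)$ is the minimum number of vertices in the smaller color class over all distinguishing vertex colorings of $G$ with two colors. When $D'(G)=2$, the cost of edge-distinguishing $\rho'(G)$ is the minimum number of edges in the smaller color class over all distinguishing edge colorings of $G$ with two colors.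
   Formalization: The claim ρ(C_n^t)=3 is stated with the single case n=5, t=1 excluded: every 2-coloring of C_5 is preserved by a reflection, so D(C_5)=3 and ρ(C_5) is undefined. -}

module Defs where

open import Data.Fin.Base using (Fin; toℕ; zero; suc)
open import Data.Nat.Base using (ℕ; zero; suc; _≤_; _⊓_; s≤s)
open import Data.Product.Base using (Σ-syntax; ∃-syntax; _×_; _,_; proj₁)
open import Data.Sum.Base using (_⊎_; inj₁; inj₂; swap)
open import Data.Unit.Base using (⊤)
open import Data.Empty using (⊥)
open import Function.Base using (_on_)
open import Function.Bundles using (_↔_; _⇔_; Func; Inverse; Equivalence)
open import Level using (0ℓ)
open import Relation.Binary.Bundles using (Setoid)
open import Relation.Binary.Definitions using (Symmetric)
open import Relation.Binary.PropositionalEquality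
  using (_≡_; refl; sym; trans; setoid)
import Relation.Binary.Construct.On as On
open import Relation.Nullary using (¬_)
open import Relation.Unary using (Pred)

record Graph : Set₁ where
  infix 4 _~_
  field
    V      : Set
    _~_    : V → V → Set
    ~-sym  : Symmetric _~_
    irrefl : ∀ {u} → ¬ (u ~ u)

open Graph using (V)

infixr 7 _□_
_□_ : Graph → Graph → Graph
G □ H = record
  { V      = G.V × H.V
  ; _~_    = λ (x , y) (x′ , y′) → (x ≡ x′ × y H.~ y′) ⊎ (x G.~ x′ × y ≡ y′)
  ; ~-sym  = λ { (inj₁ (p , q)) → inj₁ (sym p , H.~-sym q)
               ; (inj₂ (p , q)) → inj₂ (G.~-sym p , sym q) }
  ; irrefl = λ { (inj₁ (_ , q)) → H.irrefl q
               ; (inj₂ (p , _)) → G.irrefl p }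
  }
  where
  module G = Graph G
  module H = Graph H

K₁ : Graph
K₁ = record { V = ⊤ ; _~_ = λ _ _ → ⊥ ; ~-sym = λ () ; irrefl = λ () }

-- Only positive exponents matter; the value at 0 is a convention.
infixr 8 _^_
_^_ : Graph → ℕ → Graph
G ^ zero          = K₁
G ^ suc zero      = G
G ^ suc (suc k)   = G □ G ^ suc k

-- j is the cyclic successor of i in Fin n.
Next : ∀ {n} → Fin n → Fin n → Set
Next {n} i j = suc (toℕ i) ≡ toℕ j ⊎ (suc (toℕ i) ≡ n × toℕ j ≡ 0)

cycle : (n : ℕ) → 3 ≤ n → Graph
cycle n 3≤n = record
  { V      = Fin n
  ; _~_    = λ i j → Next i j ⊎ Next j i
  ; ~-sym  = swap
  ; irrefl = λ { (inj₁ p) → loopless 3≤n p ; (inj₂ p) → loopless 3≤n p }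
  }
  where
  m+1≢m : ∀ {m} → ¬ (suc m ≡ m)
  m+1≢m ()

  loopless : ∀ {n} {i : Fin n} → 3 ≤ n → ¬ Next i i
  loopless _ (inj₁ e) = m+1≢m e
  loopless {i = zero} (s≤s (s≤s _)) (inj₂ (() , _))
  loopless {i = suc _} _ (inj₂ (_ , ()))

record Automorphism (G : Graph) : Set where
  open Graph G using (_~_)
  field
    perm : V G ↔ V G
  open Inverse perm public using (to; from)
  field
    adj : ∀ u v → (u ~ v) ⇔ (to u ~ to v)

IsIdentity : ∀ {G} → Automorphism G → Set
IsIdentity {G} φ = ∀ (v : V G) → Automorphism.to φ v ≡ v

Vertices : Graph → Setoid 0ℓ 0ℓ
Vertices G = setoid (V G)

-- An edge is represented by an ordered pair of adjacent vertices, and the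
-- two orientations (and all proofs of adjacency) are identified by the setoid
-- equality, so that each undirected edge is one element of the setoid.
Edges : Graph → Setoid 0ℓ 0ℓ
Edges G = record
  { Carrier = Σ[ u ∈ V G ] Σ[ v ∈ V G ] u ~ v
  ; _≈_ = λ (u , v , _) (u′ , v′ , _) → (u ≡ u′ × v ≡ v′) ⊎ (u ≡ v′ × v ≡ u′)
  ; isEquivalence = record
    { refl  = inj₁ (refl , refl)
    ; sym   = λ { (inj₁ (p , q)) → inj₁ (sym p , sym q)
                ; (inj₂ (p , q)) → inj₂ (sym q , sym p) }
    ; trans = λ { (inj₁ (p , q)) (inj₁ (r , s)) → inj₁ (trans p r , trans q s)
                ; (inj₁ (p , q)) (inj₂ (r , s)) → inj₂ (trans p r , trans q s)
                ; (inj₂ (p , q)) (inj₁ (r , s)) → inj₂ (trans p s , trans q r)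
                ; (inj₂ (p , q)) (inj₂ (r , s)) → inj₁ (trans p s , trans q r) }
    }
  }
  where open Graph G using (_~_)

onVertices : ∀ {G} → Automorphism G →
             Setoid.Carrier (Vertices G) → Setoid.Carrier (Vertices G)
onVertices φ = Automorphism.to φ

onEdges : ∀ {G} → Automorphism G →
          Setoid.Carrier (Edges G) → Setoid.Carrier (Edges G)
onEdges φ (u , v , e) = to u , to v , Equivalence.to (adj u v) e
  where open Automorphism φ

Colouring : Setoid 0ℓ 0ℓ → ℕ → Set
Colouring S r = Func S (setoid (Fin r))

ColourClass : ∀ {S r} → Colouring S r → Fin r → Setoid 0ℓ 0ℓ
ColourClass {S} c i = On.setoid {B = Σ[ x ∈ Setoid.Carrier S ] Func.to c x ≡ i} S proj₁

HasSize : Setoid 0ℓ 0ℓ → ℕ → Set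
HasSize S m = Inverse (setoid (Fin m)) S

IsLeast : Pred ℕ 0ℓ → Pred ℕ 0ℓ
IsLeast P m = P m × (∀ m′ → P m′ → m ≤ m′)

-- Vertex and edge colourings are treated uniformly: S is the setoid of
-- coloured objects, on which the automorphisms of G act by _·_.
module Distinguishing
  (G : Graph) (S : Setoid 0ℓ 0ℓ)
  (_·_ : Automorphism G → Setoid.Carrier S → Setoid.Carrier S) where

  Preserves : ∀ {r} → Automorphism G → Colouring S r → Set
  Preserves φ c = ∀ x → Func.to c (φ · x) ≡ Func.to c x

  IsDistinguishing : ∀ {r} → Colouring S r → Set
  IsDistinguishing c = ∀ φ → Preserves φ c → IsIdentity φ

  IsNumber : ℕ → Set
  IsNumber = IsLeast (λ r → ∃[ c ] IsDistinguishing {r} c)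

  SmallerClassHasSize : Colouring S 2 → ℕ → Set
  SmallerClassHasSize c m = ∃[ a ] ∃[ b ]
    HasSize (ColourClass c zero) a × HasSize (ColourClass c (suc zero)) b × m ≡ a ⊓ b

  -- The cost is defined only when the distinguishing number is 2, and this
  -- is part of the assertion that it equals m.
  IsCost : ℕ → Set
  IsCost m = IsNumber 2 ×
    IsLeast (λ m′ → ∃[ c ] (IsDistinguishing c × SmallerClassHasSize c m′)) m

module VertexDistinguishing (G : Graph) =
  Distinguishing G (Vertices G) (onVertices {G})

module EdgeDistinguishing (G : Graph) =
  Distinguishing G (Edges G) (onEdges {G})

infix 4 D[_]≡_ D′[_]≡_ ρ[_]≡_ ρ′[_]≡_
D[_]≡_ D′[_]≡_ ρ[_]≡_ ρ′[_]≡_ : Graph → ℕ → Set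
D[  G ]≡ r = VertexDistinguishing.IsNumber G r
D′[ G ]≡ r = EdgeDistinguishing.IsNumber G r
ρ[  G ]≡ m = VertexDistinguishing.IsCost G m
ρ′[ G ]≡ m = EdgeDistinguishing.IsCost G m

{-# OPTIONS --safe #-}

-- For n ≥ 5, two edges at a vertex of a power of Cₙ span a 4-cycle exactly when
-- they are not in the same coordinate.  Hence an automorphism φ acts in the same
-- way on the directions at every vertex, and it is a permutation π of the
-- coordinates combined with a map f i of the dihedral group in each coordinate i.
--
-- Lower bounds: reflecting every coordinate exchanges any two given vertices, so
-- it preserves every set of at most two vertices and every single edge.
--
-- Upper bound for vertices: take (0,…,0), (1,…,1) and (2,3,…,t+1), or 0, 1, 3 when
-- t = 1.  Only the first two are adjacent in all coordinates.  If φ fixes them, it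
-- fixes the third vertex, whose distinct entries force π = id.  If φ swaps them,
-- it sends the first entry x of the third vertex to 1 − x, which is not an entry.
--
-- Upper bound for edges: take the edge at (0,…,0) in coordinate 0 and the edge at
-- (0,1,1,2,3,…,k−2) in coordinate 1.  If φ exchanged them, then f 0 would send 0 both
-- to 0 and to 1 or 2.  If φ preserves each, every f i fixes 0, and since the entries
-- from coordinate 2 on are distinct up to sign and none is its own negative, φ = id.

module Submission where

open import Defs
open import Data.Empty using (⊥-elim)
open import Data.Fin.Base using (Fin; zero; suc; toℕ; fromℕ; fromℕ<; inject₁; opposite)
open import Data.Fin.Induction using (<-weakInduction; >-weakInduction)
open import Data.Fin.Properties
  using (_≟_; toℕ-injective; toℕ-fromℕ; toℕ-inject₁; toℕ-fromℕ<; toℕ<n; opposite-involutive)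
open import Data.List.Base using (List; []; _∷_; length; lookup; allFin; cartesianProduct)
import Data.List.Membership.DecSetoid as ∈-DecSetoid
import Data.List.Membership.Propositional as ∈-Prop
open import Data.List.Membership.Propositional.Properties using (∈-allFin; ∈-cartesianProduct⁺)
open import Data.List.Membership.Setoid.Properties
  using (∈-lookup; All[≉]⇒∉; ∈-resp-≈; ∈-filter⁺; ∈-filter⁻; ∈-deduplicate⁺; ∈-deduplicate⁻)
open import Data.List.Relation.Unary.All using ([]; _∷_)
open import Data.List.Relation.Unary.AllPairs using ([]; _∷_)
open import Data.List.Relation.Unary.Any using (here; there; index)
open import Data.List.Relation.Unary.Any.Properties using (lookup-index)
open import Data.List.Relation.Unary.Unique.DecSetoid.Properties using (deduplicate-!)
import Data.List.Relation.Unary.Unique.Setoid as Unique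
open import Data.Nat.Base
  using (ℕ; zero; suc; _+_; _≤_; _<_; ⌊_/2⌋; ⌈_/2⌉; z≤n; s≤s; s≤s⁻¹)
open import Data.Nat.GeneralisedArithmetic using (fold; fold-+)
open import Data.Nat.Properties
  using (≤-trans; <⇒≤; ≤∧≢⇒<; m≤m+n; n≤1+n; suc-injective; +-comm; +-cancelˡ-≡; +-mono-≤; +-monoʳ-≤;
         m≤n⇒m⊓n≡m; ⊓-glb; ⌊n/2⌋-mono; ⌊n/2⌋≤⌈n/2⌉; ⌊n/2⌋+⌈n/2⌉≡n; module ≤-Reasoning)
  renaming (_≟_ to _≟ᴺ_)
open import Data.Product.Base using (Σ-syntax; ∃-syntax; _×_; _,_; proj₁; proj₂)
open import Data.Product.Properties using (≡-dec)
open import Data.Sign as Sign using (Sign)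
open import Data.Sum.Base using (_⊎_; inj₁; inj₂; [_,_]′)
open import Function.Base using (_∘_; id)
open import Function.Bundles using (Equivalence; Func; Inverse; mk⇔; mk↔ₛ′)
open import Level using (0ℓ)
open import Relation.Binary.Bundles using (Setoid; DecSetoid)
open import Relation.Binary.Definitions using (DecidableEquality) renaming (Decidable to Decidable₂)
import Relation.Binary.PropositionalEquality as ≡
open import Relation.Binary.PropositionalEquality
  using (_≡_; _≢_; refl; sym; trans; cong; cong₂; subst; subst₂; module ≡-Reasoning)
open import Relation.Nullary using (¬_; Dec; yes; no)
open import Relation.Nullary.Decidable using (_×-dec_; _⊎-dec_)

open Graph using (V; _~_)

-- Iteration, and the reversal of `Fin n`

fold-commute : ∀ {A : Set} (f g : A → A) → (∀ x → g (f x) ≡ f (g x)) →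
               ∀ x m → g (fold x f m) ≡ fold (g x) f m
fold-commute f g gf x zero    = refl
fold-commute f g gf x (suc m) = trans (gf _) (cong f (fold-commute f g gf x m))

opposite-inject₁ : ∀ {n} (i : Fin n) → opposite (inject₁ i) ≡ suc (opposite i)
opposite-inject₁ zero    = refl
opposite-inject₁ (suc i) = cong inject₁ (opposite-inject₁ i)

-- Rotations and reflections of a cycle

module _ {n : ℕ} where

  prev : Fin (suc n) → Fin (suc n)
  prev zero    = fromℕ n
  prev (suc i) = inject₁ i

  -- Conjugation by `opposite` avoids a case split at the last vertex and makes `opposite` a
  -- reflection of the cycle: `opposite-next` is an instance of `opposite-involutive`.
  next : Fin (suc n) → Fin (suc n)
  next = opposite ∘ prev ∘ opposite

  next-prev : ∀ x → next (prev x) ≡ x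
  next-prev zero    = trans (cong (opposite ∘ prev) (opposite-involutive zero)) (opposite-involutive zero)
  next-prev (suc i) = trans (cong (opposite ∘ prev) (opposite-inject₁ i))
    (trans (opposite-inject₁ (opposite i)) (cong suc (opposite-involutive i)))

  opposite-next : ∀ x → opposite (next x) ≡ prev (opposite x)
  opposite-next x = opposite-involutive (prev (opposite x))

  prev-next : ∀ x → prev (next x) ≡ x
  prev-next x = begin
    prev (next x)                       ≡⟨ opposite-involutive _ ⟨
    opposite (opposite (prev (next x))) ≡⟨ cong (λ y → opposite (opposite (prev y))) (opposite-involutive (next x)) ⟨
    opposite (next (opposite (next x))) ≡⟨ cong (opposite ∘ next) (opposite-next x) ⟩
    opposite (next (prev (opposite x))) ≡⟨ cong opposite (next-prev (opposite x)) ⟩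
    opposite (opposite x)               ≡⟨ opposite-involutive x ⟩
    x                                   ∎
    where open ≡-Reasoning

  next-injective : ∀ {x y} → next x ≡ next y → x ≡ y
  next-injective {x} {y} e = trans (sym (prev-next x)) (trans (cong prev e) (prev-next y))

  turn : Sign → Fin (suc n) → Fin (suc n)
  turn Sign.+ = next
  turn Sign.- = prev

  turn-opposite : ∀ s x → turn (Sign.opposite s) (turn s x) ≡ x
  turn-opposite Sign.+ = prev-next
  turn-opposite Sign.- = next-prev

  turn-comm : ∀ s t x → turn s (turn t x) ≡ turn t (turn s x)
  turn-comm Sign.+ Sign.+ x = refl
  turn-comm Sign.+ Sign.- x = trans (next-prev x) (sym (prev-next x))
  turn-comm Sign.- Sign.+ x = trans (prev-next x) (sym (next-prev x))
  turn-comm Sign.- Sign.- x = refl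

  -- From `x` the property climbs to the last vertex, wraps round to `zero`, and climbs again to
  -- `y`.
  next-connected : (P : Fin (suc n) → Set) → (∀ x → P x → P (next x)) → ∀ x y → P x → P y
  next-connected P P-next x y Px = <-weakInduction P P₀ (λ i → subst P (next-prev (suc i)) ∘ P-next _) y
    where
    P-last : P (fromℕ n)
    P-last = >-weakInduction (λ z → P z → P (fromℕ n)) id
      (λ i k → k ∘ subst P (next-prev (suc i)) ∘ P-next _) x Px
    P₀ : P zero
    P₀ = subst P (next-prev zero) (P-next _ P-last)

  # : ℕ → Fin (suc n)
  # = fold zero next

  toℕ-next : ∀ x → toℕ x < n → toℕ (next x) ≡ suc (toℕ x)
  toℕ-next x x<n = trans (cong toℕ next-x) (cong suc (toℕ-fromℕ< x<n))
    where
    next-x : next x ≡ suc (fromℕ< x<n)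
    next-x = trans (cong next (toℕ-injective (sym (trans (toℕ-inject₁ _) (toℕ-fromℕ< x<n)))))
      (next-prev (suc (fromℕ< x<n)))

  toℕ-# : ∀ m → m ≤ n → toℕ (# m) ≡ m
  toℕ-# zero    _   = refl
  toℕ-# (suc m) m<n = trans (toℕ-next (# m) (subst (_< n) (sym ih) m<n)) (cong suc ih)
    where ih = toℕ-# m (<⇒≤ m<n)

  -- From `zero` the position `toℕ` counts the steps, as long as there are at most `n` of them. The
  -- claim moves to any other start because `next` is injective and commutes with its iterates.
  fold-next-injective : ∀ {a b} → a ≤ n → b ≤ n → ∀ x → fold x next a ≡ fold x next b → a ≡ b
  fold-next-injective {a} {b} a≤n b≤n x =
    next-connected (λ x → fold x next a ≡ fold x next b → a ≡ b)
      (λ x ih e → ih (next-injective (trans (fold-commute next next (λ _ → refl) x a)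
        (trans e (sym (fold-commute next next (λ _ → refl) x b))))))
      zero x
      (λ e → trans (sym (toℕ-# a a≤n)) (trans (cong toℕ e) (toℕ-# b b≤n)))

  fold-next-fixed : ∀ {m} → suc m ≤ n → ∀ x → fold x next (suc m) ≢ x
  fold-next-fixed m<n x e with () ← fold-next-injective m<n z≤n x e

  fold-prev-next : ∀ x m → fold (fold x prev m) next m ≡ x
  fold-prev-next x zero    = refl
  fold-prev-next x (suc m) = begin
    next (fold (prev (fold x prev m)) next m) ≡⟨ fold-commute next next (λ _ → refl) _ m ⟩
    fold (next (prev (fold x prev m))) next m ≡⟨ cong (λ y → fold y next m) (next-prev _) ⟩
    fold (fold x prev m) next m               ≡⟨ fold-prev-next x m ⟩
    x                                         ∎
    where open ≡-Reasoning

  turn-fixed : 1 ≤ n → ∀ s x → turn s x ≢ x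
  turn-fixed 1≤n Sign.+ x e = fold-next-fixed 1≤n x e
  turn-fixed 1≤n Sign.- x e = fold-next-fixed 1≤n (prev x) (trans (next-prev x) (sym e))

  turn-injectiveˡ : 2 ≤ n → ∀ s t x → turn s x ≡ turn t x → s ≡ t
  turn-injectiveˡ 2≤n Sign.+ Sign.+ x e = refl
  turn-injectiveˡ 2≤n Sign.- Sign.- x e = refl
  turn-injectiveˡ 2≤n Sign.+ Sign.- x e =
    ⊥-elim (fold-next-fixed 2≤n x (trans (cong next e) (next-prev x)))
  turn-injectiveˡ 2≤n Sign.- Sign.+ x e =
    ⊥-elim (fold-next-fixed 2≤n x (trans (cong next (sym e)) (next-prev x)))

  infix 4 _∼_
  _∼_ : Fin (suc n) → Fin (suc n) → Set
  x ∼ y = ∃[ s ] y ≡ turn s x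

  ∼-sym : ∀ {x y} → x ∼ y → y ∼ x
  ∼-sym (s , refl) = Sign.opposite s , sym (turn-opposite s _)

  -- Equivariance describes the dihedral group: the rotations have sign `Sign.+` and the reflections
  -- `Sign.-`.
  Dihedral : Sign → (Fin (suc n) → Fin (suc n)) → Set
  Dihedral s f = ∀ b x → f (turn b x) ≡ turn (b Sign.* s) (f x)

  dihedral : ∀ s (f : Fin (suc n) → Fin (suc n)) → (∀ x → f (next x) ≡ turn s (f x)) → Dihedral s f
  dihedral s f f-next Sign.+ x = f-next x
  dihedral s f f-next Sign.- x = begin
    f (prev x)                               ≡⟨ turn-opposite s _ ⟨
    turn (Sign.opposite s) (turn s (f (prev x))) ≡⟨ cong (turn (Sign.opposite s)) (f-next (prev x)) ⟨
    turn (Sign.opposite s) (f (next (prev x)))   ≡⟨ cong (turn (Sign.opposite s) ∘ f) (next-prev x) ⟩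
    turn (Sign.opposite s) (f x)                 ∎
    where open ≡-Reasoning

  dihedral-∼ : ∀ {s f} → Dihedral s f → ∀ {x y} → x ∼ y → f x ∼ f y
  dihedral-∼ {s} D (b , refl) = b Sign.* s , D b _

  -- Following `opposite` by rotations makes the image of `u` run through the cycle. Each composite
  -- is again an involution, since a reflection turns `next` into `prev`.
  reflection : ∀ u v → ∃[ f ] Dihedral Sign.- f × (∀ x → f (f x) ≡ x) × f u ≡ v
  reflection u v = next-connected
    (λ v → ∃[ f ] Dihedral Sign.- f × (∀ x → f (f x) ≡ x) × f u ≡ v)
    (λ v (f , D , inv , e) → next ∘ f
      , dihedral Sign.- (next ∘ f) (λ x → trans (cong next (D Sign.+ x)) (turn-comm Sign.+ Sign.- (f x)))
      , (λ x → trans (cong next (D Sign.+ (f x))) (trans (next-prev _) (inv x)))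
      , cong next e)
    (opposite u) v
    (opposite , dihedral Sign.- opposite opposite-next , opposite-involutive , refl)

  dihedralMap : ∀ s u v → ∃[ f ] Dihedral s f × f u ≡ v
  dihedralMap Sign.- u v with f , D , _ , e ← reflection u v = f , D , e
  dihedralMap Sign.+ u v = next-connected (λ v → ∃[ f ] Dihedral Sign.+ f × f u ≡ v)
    (λ v (f , D , e) → next ∘ f , dihedral Sign.+ (next ∘ f) (λ x → cong next (D Sign.+ x)) , cong next e)
    u v
    (id , dihedral Sign.+ id (λ _ → refl) , refl)

  dihedral-fold : ∀ {s f} → Dihedral s f → ∀ x m → f (fold x next m) ≡ fold (f x) (turn s) m
  dihedral-fold         D x zero    = refl
  dihedral-fold {s} {f} D x (suc m) = trans (D Sign.+ _) (cong (turn s) (dihedral-fold D x m))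

  rotation-fixing : ∀ {f} → Dihedral Sign.+ f → ∀ {x} → f x ≡ x → ∀ y → f y ≡ y
  rotation-fixing {f} D e y = next-connected (λ y → f y ≡ y)
    (λ x ih → trans (D Sign.+ x) (cong next ih)) _ y e

  -- A reflection fixing 0 sends `suc m` to its negative, so the image could be `m′` only if the
  -- cycle length `suc n` divided `suc m + m′`, which is positive and at most `n`.
  dihedral-fixing : ∀ {s f} → Dihedral s f → f zero ≡ zero →
                    ∀ m m′ → f (# (suc m)) ≡ # m′ → suc m + m′ ≤ n → ∀ x → f x ≡ x
  dihedral-fixing {Sign.+}     D f₀ m m′ e le = rotation-fixing D f₀
  dihedral-fixing {Sign.-} {f} D f₀ m m′ e le x = ⊥-elim (fold-next-fixed le zero (begin
    # (suc m + m′)                           ≡⟨ fold-+ zero next (suc m) ⟩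
    fold (# m′) next (suc m)                 ≡⟨ cong (λ y → fold y next (suc m)) e ⟨
    fold (f (# (suc m))) next (suc m)        ≡⟨ cong (λ y → fold y next (suc m)) (dihedral-fold D zero (suc m)) ⟩
    fold (fold (f zero) prev (suc m)) next (suc m) ≡⟨ fold-prev-next (f zero) (suc m) ⟩
    f zero                                   ≡⟨ f₀ ⟩
    zero                                     ∎))
    where open ≡-Reasoning

-- Powers of a cycle in coordinates

module Torus {n : ℕ} (3≤n : 3 ≤ suc n) where

  C : Graph
  C = cycle (suc n) 3≤n

  Next⇒next : ∀ {i j : Fin (suc n)} → Next i j → j ≡ next i
  Next⇒next {i} {j} p = trans (sym (next-prev j)) (cong next (sym (toℕ-injective (lemma j p))))
    where
    lemma : ∀ j → Next i j → toℕ i ≡ toℕ (prev j)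
    lemma zero    (inj₂ (e , _)) = trans (suc-injective e) (sym (toℕ-fromℕ n))
    lemma (suc j) (inj₁ e)       = trans (suc-injective e) (sym (toℕ-inject₁ j))

  Next-prev : ∀ (j : Fin (suc n)) → Next (prev j) j
  Next-prev zero    = inj₂ (cong suc (toℕ-fromℕ n) , refl)
  Next-prev (suc j) = inj₁ (cong suc (toℕ-inject₁ j))

  ~⇒∼ : ∀ {x y} → _~_ C x y → x ∼ y
  ~⇒∼ (inj₁ p) = Sign.+ , Next⇒next p
  ~⇒∼ (inj₂ p) = ∼-sym (Sign.+ , Next⇒next p)

  ~-turn : ∀ s x → _~_ C x (turn s x)
  ~-turn Sign.+ x = inj₁ (subst (λ y → Next y (next x)) (prev-next x) (Next-prev (next x)))
  ~-turn Sign.- x = inj₂ (Next-prev x)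

  Dir : ℕ → Set
  Dir k = Fin (suc k) × Sign

  X : ℕ → Set
  X k = V (C ^ suc k)

  coord : ∀ k → X k → Fin (suc k) → Fin (suc n)
  coord zero    x       zero    = x
  coord (suc k) (x , _) zero    = x
  coord (suc k) (_ , y) (suc i) = coord k y i

  step : ∀ k → Dir k → X k → X k
  step zero    (zero  , s) x       = turn s x
  step (suc k) (zero  , s) (x , y) = turn s x , y
  step (suc k) (suc i , s) (x , y) = x , step k (i , s) y

  tabulate : ∀ k → (Fin (suc k) → Fin (suc n)) → X k
  tabulate zero    f = f zero
  tabulate (suc k) f = f zero , tabulate k (f ∘ suc)

  coord-tabulate : ∀ k f i → coord k (tabulate k f) i ≡ f i
  coord-tabulate zero    f zero    = refl
  coord-tabulate (suc k) f zero    = refl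
  coord-tabulate (suc k) f (suc i) = coord-tabulate k (f ∘ suc) i

  coord-ext : ∀ k {x y} → (∀ i → coord k x i ≡ coord k y i) → x ≡ y
  coord-ext zero    h = h zero
  coord-ext (suc k) h = cong₂ _,_ (h zero) (coord-ext k (h ∘ suc))

  coord-step : ∀ k i s x → coord k (step k (i , s) x) i ≡ turn s (coord k x i)
  coord-step zero    zero    s x       = refl
  coord-step (suc k) zero    s x       = refl
  coord-step (suc k) (suc i) s (_ , y) = coord-step k i s y

  coord-step-≢ : ∀ k {i j} s x → j ≢ i → coord k (step k (i , s) x) j ≡ coord k x j
  coord-step-≢ zero    {zero}  {zero}  s x       j≢i = ⊥-elim (j≢i refl)
  coord-step-≢ (suc k) {zero}  {zero}  s x       j≢i = ⊥-elim (j≢i refl)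
  coord-step-≢ (suc k) {zero}  {suc j} s x       j≢i = refl
  coord-step-≢ (suc k) {suc i} {zero}  s x       j≢i = refl
  coord-step-≢ (suc k) {suc i} {suc j} s (_ , y) j≢i = coord-step-≢ k s y (j≢i ∘ cong suc)

  step-comm : ∀ k d e x → step k d (step k e x) ≡ step k e (step k d x)
  step-comm zero    (zero  , s) (zero  , t) x       = turn-comm s t x
  step-comm (suc k) (zero  , s) (zero  , t) (x , y) = cong (_, y) (turn-comm s t x)
  step-comm (suc k) (zero  , s) (suc j , t) x       = refl
  step-comm (suc k) (suc i , s) (zero  , t) x       = refl
  step-comm (suc k) (suc i , s) (suc j , t) (x , y) = cong (x ,_) (step-comm k (i , s) (j , t) y)

  neg : ∀ {k} → Dir k → Dir k
  neg (i , s) = i , Sign.opposite s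

  neg-involutive : ∀ {k} (d : Dir k) → neg (neg d) ≡ d
  neg-involutive (i , Sign.+) = refl
  neg-involutive (i , Sign.-) = refl

  neg≢ : ∀ {k} (d : Dir k) → neg d ≢ d
  neg≢ (i , Sign.+) ()
  neg≢ (i , Sign.-) ()

  step-neg : ∀ k d x → step k (neg d) (step k d x) ≡ x
  step-neg zero    (zero  , s) x       = turn-opposite s x
  step-neg (suc k) (zero  , s) (x , y) = cong (_, y) (turn-opposite s x)
  step-neg (suc k) (suc i , s) (x , y) = cong (x ,_) (step-neg k (i , s) y)

  ~⇒step : ∀ k {x y} → _~_ (C ^ suc k) x y → ∃[ d ] y ≡ step k d x
  ~⇒step zero    x~y with s , e ← ~⇒∼ x~y = (zero , s) , e
  ~⇒step (suc k) (inj₁ (refl , y~y′)) with (i , s) , refl ← ~⇒step k y~y′ = (suc i , s) , refl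
  ~⇒step (suc k) (inj₂ (x~x′ , refl)) with s , refl ← ~⇒∼ x~x′ = (zero , s) , refl

  ~-step : ∀ k d x → _~_ (C ^ suc k) x (step k d x)
  ~-step zero    (zero  , s) x       = ~-turn s x
  ~-step (suc k) (zero  , s) (x , _) = inj₂ (~-turn s x , refl)
  ~-step (suc k) (suc i , s) (_ , y) = inj₁ (refl , ~-step k (i , s) y)

  step-connected : ∀ k (P : X k → Set) → (∀ i x → P x → P (step k (i , Sign.+) x)) →
                   ∀ x y → P x → P y
  step-connected zero    P P-step x y Px = next-connected P (P-step zero) x y Px
  step-connected (suc k) P P-step (x , y) (x′ , y′) Pxy =
    step-connected k (λ z → P (x′ , z)) (λ i z → P-step (suc i) (x′ , z)) y y′
      (next-connected (λ z → P (z , y)) (λ z → P-step zero (z , y)) x x′ Pxy)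

  step-injective : 2 ≤ n → ∀ k d e x → step k d x ≡ step k e x → d ≡ e
  step-injective 2≤n k (i , s) (j , t) x eq with i ≟ j
  ... | yes refl = cong (i ,_) (turn-injectiveˡ 2≤n s t (coord k x i)
    (trans (sym (coord-step k i s x)) (trans (cong (λ y → coord k y i) eq) (coord-step k i t x))))
  ... | no  i≢j  = ⊥-elim (turn-fixed (<⇒≤ 2≤n) s (coord k x i)
    (trans (sym (coord-step k i s x)) (trans (cong (λ y → coord k y i) eq) (coord-step-≢ k t x i≢j))))

  -- The displacement of coordinate c under a step, plus one.
  data Mark {k} (c : Fin (suc k)) : Dir k → ℕ → Set where
    up   : Mark c (c , Sign.+) 2
    down : Mark c (c , Sign.-) 0
    away : ∀ {i s} → c ≢ i → Mark c (i , s) 1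

  mark : ∀ {k} c (d : Dir k) → ∃[ a ] Mark c d a
  mark c (i , s) with c ≟ i
  mark c (i , Sign.+) | yes refl = 2 , up
  mark c (i , Sign.-) | yes refl = 0 , down
  mark c (i , s)      | no  c≢i  = 1 , away c≢i

  mark-≤ : ∀ {k c} {d : Dir k} {a} → Mark c d a → a ≤ 2
  mark-≤ up       = s≤s (s≤s z≤n)
  mark-≤ down     = z≤n
  mark-≤ (away _) = s≤s z≤n

  mark-injective : ∀ {k c s} {e : Dir k} {a} → Mark c (c , s) a → Mark c e a → e ≡ (c , s)
  mark-injective up         up   = refl
  mark-injective down       down = refl
  mark-injective (away c≢c) _    = ⊥-elim (c≢c refl)

  coord-mark : ∀ k {c d a} x → Mark c d a → coord k (step k d x) c ≡ fold (prev (coord k x c)) next a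
  coord-mark k {c} x up         = trans (coord-step k c Sign.+ x) (cong next (sym (next-prev (coord k x c))))
  coord-mark k {c} x down       = coord-step k c Sign.- x
  coord-mark k {c} x (away c≢i) = trans (coord-step-≢ k _ x c≢i) (sym (next-prev (coord k x c)))

  coord-marks : ∀ k {c d e a b} x → Mark c d a → Mark c e b →
                coord k (step k d (step k e x)) c ≡ fold (prev (prev (coord k x c))) next (a + b)
  coord-marks k {c} {d} {e} {a} {b} x md me = begin
    coord k (step k d (step k e x)) c                  ≡⟨ coord-mark k (step k e x) md ⟩
    fold (prev (coord k (step k e x) c)) next a        ≡⟨ cong (λ y → fold (prev y) next a) (coord-mark k x me) ⟩
    fold (prev (fold (prev (coord k x c)) next b)) next a
      ≡⟨ cong (λ y → fold y next a) (fold-commute next prev (turn-comm Sign.- Sign.+) (prev (coord k x c)) b) ⟩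
    fold (fold (prev (prev (coord k x c))) next b) next a ≡⟨ fold-+ _ next a ⟨
    fold (prev (prev (coord k x c))) next (a + b)      ∎
    where open ≡-Reasoning

  -- The displacement vectors satisfy `d + e = d′ + e′`; the offset in the marks adds 2 to both
  -- sides and keeps the sums in the natural numbers.
  Balanced : ∀ {k} (d e d′ e′ : Dir k) → Set
  Balanced d e d′ e′ = ∀ c {a b a′ b′} → Mark c d a → Mark c e b → Mark c d′ a′ → Mark c e′ b′ →
    a + b ≡ b′ + a′

  -- Positions determine the sums of marks only modulo `suc n`. As these sums are at most 4 and the
  -- cycle has at least five vertices, they are equal; on a 4-cycle this would fail.
  square-balanced : 4 ≤ n → ∀ k {d e d′ e′} x →
    step k d (step k e x) ≡ step k e′ (step k d′ x) → Balanced d e d′ e′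
  square-balanced 4≤n k x eq c md me md′ me′ = fold-next-injective
    (≤-trans (+-mono-≤ (mark-≤ md) (mark-≤ me)) 4≤n)
    (≤-trans (+-mono-≤ (mark-≤ me′) (mark-≤ md′)) 4≤n) _
    (trans (sym (coord-marks k x md me))
      (trans (cong (λ y → coord k y c) eq) (coord-marks k x me′ md′)))

  -- A nonzero sum of two signed unit vectors determines both summands up to order, so `d′` is `d`
  -- or `e`. The proof reads the equation in the coordinate `i` of `d`.
  balanced-parallel : ∀ {k} {d e d′ e′ : Dir k} → Balanced d e d′ e′ → d ≢ neg e → e ≢ d′ → d ≡ d′
  balanced-parallel {k} {i , s} {e} {i′ , s′} {e′} bal d≢-e e≢d′ = go s (mark i e) (mark i (i′ , s′)) (mark i e′) refl
    where
    -- If `e′` makes the step in coordinate `i`, then in coordinate `i′` only `e` and `d′` can move,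
    -- so they agree there and are equal.
    elsewhere : ∀ {t} → e′ ≡ (i , t) → i ≢ i′ → (i , s) ≡ (i′ , s′)
    elsewhere refl i≢i′ with mark i′ e | mark i′ (i′ , s′)
    ... | _ , me | _ , md′ with refl ← suc-injective (bal i′ (away (i≢i′ ∘ sym)) me md′ (away (i≢i′ ∘ sym))) =
      ⊥-elim (e≢d′ (mark-injective md′ me))

    go : ∀ t → ∃[ b ] Mark i e b → ∃[ a ] Mark i (i′ , s′) a → ∃[ b ] Mark i e′ b → s ≡ t → (i , s) ≡ (i′ , s′)
    go Sign.+ _ (_ , up) _ refl = refl
    go Sign.+ (_ , down) _ _ refl = ⊥-elim (d≢-e refl)
    go Sign.+ (_ , up) (_ , down) (_ , up) refl with () ← bal i up up down up
    go Sign.+ (_ , up) (_ , down) (_ , down) refl with () ← bal i up up down down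
    go Sign.+ (_ , up) (_ , down) (_ , away r) refl with () ← bal i up up down (away r)
    go Sign.+ (_ , up) (_ , away q) (_ , up) refl with () ← bal i up up (away q) up
    go Sign.+ (_ , up) (_ , away q) (_ , down) refl with () ← bal i up up (away q) down
    go Sign.+ (_ , up) (_ , away q) (_ , away r) refl with () ← bal i up up (away q) (away r)
    go Sign.+ (_ , away p) (_ , down) (_ , up) refl with () ← bal i up (away p) down up
    go Sign.+ (_ , away p) (_ , down) (_ , down) refl with () ← bal i up (away p) down down
    go Sign.+ (_ , away p) (_ , down) (_ , away r) refl with () ← bal i up (away p) down (away r)
    go Sign.+ (_ , away p) (_ , away q) (_ , down) refl with () ← bal i up (away p) (away q) down
    go Sign.+ (_ , away p) (_ , away q) (_ , away r) refl with () ← bal i up (away p) (away q) (away r)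
    go Sign.+ _ (_ , away i≢i′) (_ , up) refl = elsewhere refl i≢i′
    go Sign.- _ (_ , down) _ refl = refl
    go Sign.- (_ , up) _ _ refl = ⊥-elim (d≢-e refl)
    go Sign.- (_ , down) (_ , up) (_ , up) refl with () ← bal i down down up up
    go Sign.- (_ , down) (_ , up) (_ , down) refl with () ← bal i down down up down
    go Sign.- (_ , down) (_ , up) (_ , away r) refl with () ← bal i down down up (away r)
    go Sign.- (_ , down) (_ , away q) (_ , up) refl with () ← bal i down down (away q) up
    go Sign.- (_ , down) (_ , away q) (_ , down) refl with () ← bal i down down (away q) down
    go Sign.- (_ , down) (_ , away q) (_ , away r) refl with () ← bal i down down (away q) (away r)
    go Sign.- (_ , away p) (_ , up) (_ , up) refl with () ← bal i down (away p) up up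
    go Sign.- (_ , away p) (_ , up) (_ , down) refl with () ← bal i down (away p) up down
    go Sign.- (_ , away p) (_ , up) (_ , away r) refl with () ← bal i down (away p) up (away r)
    go Sign.- (_ , away p) (_ , away q) (_ , up) refl with () ← bal i down (away p) (away q) up
    go Sign.- (_ , away p) (_ , away q) (_ , away r) refl with () ← bal i down (away p) (away q) (away r)
    go Sign.- _ (_ , away i≢i′) (_ , down) refl = elsewhere refl i≢i′

  square : 4 ≤ n → ∀ k {d e d′ e′} x → step k d (step k e x) ≡ step k e′ (step k d′ x) →
           d ≢ neg e → e ≢ d′ → d ≡ d′
  square 4≤n k x eq = balanced-parallel (square-balanced 4≤n k x eq)

  _≟ᵈ_ : ∀ {k} (d e : Dir k) → Dec (d ≡ e)
  _≟ᵈ_ = ≡-dec _≟_ Sign._≟_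

  -- Automorphisms as coordinate permutations with dihedral maps

  module Classification (4≤n : 4 ≤ n) {k} (φ : Automorphism (C ^ suc k)) where
    open Automorphism φ

    private
      2≤n : 2 ≤ n
      2≤n = ≤-trans (m≤m+n 2 2) 4≤n

    to-from : ∀ x → to (from x) ≡ x
    to-from = Inverse.strictlyInverseˡ perm

    from-to : ∀ x → from (to x) ≡ x
    from-to = Inverse.strictlyInverseʳ perm

    to-injective : ∀ {x y} → to x ≡ to y → x ≡ y
    to-injective {x} {y} e = trans (sym (from-to x)) (trans (cong from e) (from-to y))

    σ : X k → Dir k → Dir k
    σ x d = proj₁ (~⇒step k (Equivalence.to (adj x _) (~-step k d x)))

    to-step : ∀ x d → to (step k d x) ≡ step k (σ x d) (to x)
    to-step x d = proj₂ (~⇒step k (Equivalence.to (adj x _) (~-step k d x)))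

    σ-injective : ∀ x {d e} → σ x d ≡ σ x e → d ≡ e
    σ-injective x {d} {e} eq = step-injective 2≤n k d e x (to-injective
      (trans (to-step x d) (trans (cong (λ a → step k a (to x)) eq) (sym (to-step x e)))))

    σ-surjective : ∀ x e → ∃[ d ] σ x d ≡ e
    σ-surjective x e = d , step-injective 2≤n k _ e (to x) (begin
      step k (σ x d) (to x)      ≡⟨ to-step x d ⟨
      to (step k d x)            ≡⟨ cong to d-eq ⟨
      to (from (step k e (to x))) ≡⟨ to-from _ ⟩
      step k e (to x)            ∎)
      where
      open ≡-Reasoning
      edge : ∃[ d ] from (step k e (to x)) ≡ step k d x
      edge = ~⇒step k (Equivalence.from (adj x _)
        (subst (_~_ (C ^ suc k) (to x)) (sym (to-from _)) (~-step k e (to x))))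
      d = proj₁ edge
      d-eq = proj₂ edge

    σ-back : ∀ x e → σ (step k e x) (neg e) ≡ neg (σ x e)
    σ-back x e = step-injective 2≤n k _ _ (step k (σ x e) (to x)) (begin
      step k (σ (step k e x) (neg e)) (step k (σ x e) (to x)) ≡⟨ cong (step k _) (to-step x e) ⟨
      step k (σ (step k e x) (neg e)) (to (step k e x))       ≡⟨ to-step (step k e x) (neg e) ⟨
      to (step k (neg e) (step k e x))                        ≡⟨ cong to (step-neg k e x) ⟩
      to x                                                    ≡⟨ step-neg k (σ x e) (to x) ⟨
      step k (neg (σ x e)) (step k (σ x e) (to x))            ∎)
      where open ≡-Reasoning

    -- The automorphism carries the square spanned by `d` and `e` at `x` to two routes with a common
    -- end, to which `square` applies; injectivity of `σ` supplies the two side conditions.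
    σ-across : ∀ x {d e} → d ≢ e → d ≢ neg e → σ (step k e x) d ≡ σ x d
    σ-across x {d} {e} d≢e d≢-e = square 4≤n k (to x) (begin
      step k (σ (step k e x) d) (step k (σ x e) (to x)) ≡⟨ cong (step k _) (to-step x e) ⟨
      step k (σ (step k e x) d) (to (step k e x))       ≡⟨ to-step (step k e x) d ⟨
      to (step k d (step k e x))                        ≡⟨ cong to (step-comm k d e x) ⟩
      to (step k e (step k d x))                        ≡⟨ to-step (step k d x) e ⟩
      step k (σ (step k d x) e) (to (step k d x))       ≡⟨ cong (step k _) (to-step x d) ⟩
      step k (σ (step k d x) e) (step k (σ x d) (to x)) ∎)
      (λ eq → d≢-e (σ-injective (step k e x) (trans eq (sym (σ-back x e)))))
      (λ eq → d≢e (sym (σ-injective x eq)))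
      where open ≡-Reasoning

    -- Some direction `d` goes to `neg (σ x e)`. Were it neither `e` nor `neg e`, it would keep its
    -- image after the step along `e`, where `neg e` already has that image by `σ-back`.
    σ-neg : ∀ x e → σ x (neg e) ≡ neg (σ x e)
    σ-neg x e with σ-surjective x (neg (σ x e))
    ... | d , eq with d ≟ᵈ e | d ≟ᵈ neg e
    ...   | yes refl | _        = ⊥-elim (neg≢ (σ x e) (sym eq))
    ...   | no _     | yes refl = eq
    ...   | no d≢e   | no d≢-e  = ⊥-elim (d≢-e (σ-injective (step k e x)
      (trans (σ-across x d≢e d≢-e) (trans eq (sym (σ-back x e))))))

    σ-along : ∀ x e → σ (step k e x) e ≡ σ x e
    σ-along x e = begin
      σ (step k e x) e             ≡⟨ cong (σ (step k e x)) (neg-involutive e) ⟨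
      σ (step k e x) (neg (neg e)) ≡⟨ σ-neg (step k e x) (neg e) ⟩
      neg (σ (step k e x) (neg e)) ≡⟨ cong neg (σ-back x e) ⟩
      neg (neg (σ x e))            ≡⟨ neg-involutive (σ x e) ⟩
      σ x e                        ∎
      where open ≡-Reasoning

    σ-step : ∀ x d e → σ (step k e x) d ≡ σ x d
    σ-step x d e with d ≟ᵈ e | d ≟ᵈ neg e
    ... | yes refl | _        = σ-along x e
    ... | no _     | yes refl = trans (σ-back x e) (sym (σ-neg x e))
    ... | no d≢e   | no d≢-e  = σ-across x d≢e d≢-e

    origin : X k
    origin = tabulate k (λ _ → zero)

    σ-constant : ∀ x d → σ x d ≡ σ origin d
    σ-constant x d = step-connected k (λ y → σ y d ≡ σ origin d)
      (λ i y → trans (σ-step y d (i , Sign.+))) origin x refl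

    π : Fin (suc k) → Fin (suc k)
    π i = proj₁ (σ origin (i , Sign.+))

    sign : Fin (suc k) → Sign
    sign i = proj₂ (σ origin (i , Sign.+))

    π-surjective : ∀ l → ∃[ i ] π i ≡ l
    π-surjective l with σ-surjective origin (l , Sign.+)
    ... | (i , Sign.+) , eq = i , cong proj₁ eq
    ... | (i , Sign.-) , eq = i , cong proj₁ (trans (sym (σ-neg origin (i , Sign.+))) eq)

    π-injective : ∀ {i j} → π i ≡ π j → i ≡ j
    π-injective {i} {j} eq with sign i Sign.≟ sign j
    ... | yes s≡ = cong proj₁ (σ-injective origin (cong₂ _,_ eq s≡))
    ... | no  s≢ = cong proj₁ (σ-injective origin {i , Sign.+} {j , Sign.-}
      (trans (cong₂ _,_ eq (≢⇒opposite s≢)) (sym (σ-neg origin (j , Sign.+)))))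
      where
      ≢⇒opposite : ∀ {s t} → s ≢ t → s ≡ Sign.opposite t
      ≢⇒opposite {Sign.+} {Sign.+} s≢t = ⊥-elim (s≢t refl)
      ≢⇒opposite {Sign.+} {Sign.-} _   = refl
      ≢⇒opposite {Sign.-} {Sign.+} _   = refl
      ≢⇒opposite {Sign.-} {Sign.-} s≢t = ⊥-elim (s≢t refl)

    private
      -- A dihedral map is determined by its sign and one value; both are read off at the origin.
      f-spec : ∀ i → ∃[ g ] Dihedral (sign i) g × g zero ≡ coord k (to origin) (π i)
      f-spec i = dihedralMap (sign i) zero _

    f : Fin (suc k) → Fin (suc n) → Fin (suc n)
    f i = proj₁ (f-spec i)

    f-dihedral : ∀ i → Dihedral (sign i) (f i)
    f-dihedral i = proj₁ (proj₂ (f-spec i))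

    to-step⁺ : ∀ j x → to (step k (j , Sign.+) x) ≡ step k (π j , sign j) (to x)
    to-step⁺ j x = trans (to-step x _) (cong (λ d → step k d (to x)) (σ-constant x _))

    -- The two sides agree at the origin by the choice of `f i`, and a positive step in coordinate
    -- `j` changes both in the same way: by a turn of sign `sign j` if `i = j`, not at all
    -- otherwise.
    coord-to : ∀ x i → coord k (to x) (π i) ≡ f i (coord k x i)
    coord-to x = step-connected k (λ x → ∀ i → coord k (to x) (π i) ≡ f i (coord k x i))
      closed origin x base
      where
      base : ∀ i → coord k (to origin) (π i) ≡ f i (coord k origin i)
      base i = trans (sym (proj₂ (proj₂ (f-spec i)))) (cong (f i) (sym (coord-tabulate k _ i)))

      closed : ∀ j x → (∀ i → coord k (to x) (π i) ≡ f i (coord k x i)) →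
               ∀ i → coord k (to (step k (j , Sign.+) x)) (π i) ≡ f i (coord k (step k (j , Sign.+) x) i)
      closed j x ih i with i ≟ j
      ... | yes refl = begin
        coord k (to (step k (i , Sign.+) x)) (π i)         ≡⟨ cong (λ y → coord k y (π i)) (to-step⁺ i x) ⟩
        coord k (step k (π i , sign i) (to x)) (π i)       ≡⟨ coord-step k (π i) (sign i) (to x) ⟩
        turn (sign i) (coord k (to x) (π i))               ≡⟨ cong (turn (sign i)) (ih i) ⟩
        turn (sign i) (f i (coord k x i))                  ≡⟨ f-dihedral i Sign.+ (coord k x i) ⟨
        f i (next (coord k x i))                           ≡⟨ cong (f i) (coord-step k i Sign.+ x) ⟨
        f i (coord k (step k (i , Sign.+) x) i)            ∎
        where open ≡-Reasoning
      ... | no i≢j = begin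
        coord k (to (step k (j , Sign.+) x)) (π i)         ≡⟨ cong (λ y → coord k y (π i)) (to-step⁺ j x) ⟩
        coord k (step k (π j , sign j) (to x)) (π i)       ≡⟨ coord-step-≢ k (sign j) (to x) (i≢j ∘ π-injective) ⟩
        coord k (to x) (π i)                               ≡⟨ ih i ⟩
        f i (coord k x i)                                  ≡⟨ cong (f i) (coord-step-≢ k Sign.+ x i≢j) ⟨
        f i (coord k (step k (j , Sign.+) x) i)            ∎
        where open ≡-Reasoning

    f-at : ∀ x i {y p q} → to x ≡ y → coord k x i ≡ p → coord k y (π i) ≡ q → f i p ≡ q
    f-at x i refl refl refl = sym (coord-to x i)

    isIdentity : (∀ i → π i ≡ i) → (∀ i y → f i y ≡ y) → IsIdentity φ
    isIdentity π-id f-id x = coord-ext k λ i → begin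
      coord k (to x) i     ≡⟨ cong (coord k (to x)) (π-id i) ⟨
      coord k (to x) (π i) ≡⟨ coord-to x i ⟩
      f i (coord k x i)    ≡⟨ f-id i (coord k x i) ⟩
      coord k x i          ∎
      where open ≡-Reasoning

-- Sizes of colour classes and the cost of distinguishing

module _ (S : Setoid 0ℓ 0ℓ) where
  open Setoid S using (_≈_)
  open Unique S using (Unique)

  lookup-injective : ∀ {xs} → Unique xs → ∀ i j → lookup xs i ≈ lookup xs j → i ≡ j
  lookup-injective (_  ∷ _) zero    zero    _ = refl
  lookup-injective (x≉ ∷ _) zero    (suc j) e =
    ⊥-elim (All[≉]⇒∉ S x≉ (∈-resp-≈ S (Setoid.sym S e) (∈-lookup S _ j)))
  lookup-injective (x≉ ∷ _) (suc i) zero    e =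
    ⊥-elim (All[≉]⇒∉ S x≉ (∈-resp-≈ S e (∈-lookup S _ i)))
  lookup-injective (_  ∷ u) (suc i) (suc j) e = cong suc (lookup-injective u i j e)

module Cost (G : Graph) (DS : DecSetoid 0ℓ 0ℓ)
            (_·_ : Automorphism G → DecSetoid.Carrier DS → DecSetoid.Carrier DS) where
  open DecSetoid DS using (_≈_) renaming (Carrier to A; setoid to S; _≟_ to _≈?_)
  open Distinguishing G S _·_
  open ∈-DecSetoid DS using (_∈_; _∈?_)
  open Unique S using (Unique)

  class-size : (c : Colouring S 2) (i : Fin 2) → ∀ {ys} → Unique ys →
               (∀ {x} → Func.to c x ≡ i → x ∈ ys) → (∀ {x} → x ∈ ys → Func.to c x ≡ i) →
               HasSize (ColourClass c i) (length ys)
  class-size c i {ys} u complete sound = record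
    { to        = λ j → lookup ys j , sound (∈-lookup S ys j)
    ; from      = λ (_ , cx) → index (complete cx)
    ; to-cong   = λ { refl → DecSetoid.refl DS }
    ; from-cong = λ {(x , cx)} {(y , cy)} x≈y → lookup-injective S u _ _
        (DecSetoid.trans DS (DecSetoid.sym DS (lookup-index (complete cx)))
          (DecSetoid.trans DS x≈y (lookup-index (complete cy))))
    ; inverse   = (λ { {x , cx} refl → DecSetoid.sym DS (lookup-index (complete cx)) })
                , (λ {j} {(x , cx)} x≈ → lookup-injective S u _ _
                    (DecSetoid.trans DS (DecSetoid.sym DS (lookup-index (complete cx))) x≈))
    }

  class-finite : (∃[ xs ] (∀ x → x ∈ xs)) → (c : Colouring S 2) (i : Fin 2) →
                 ∃[ m ] HasSize (ColourClass c i) m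
  class-finite (xs , all∈) c i = _ , class-size c i (deduplicate-! DS _)
    (λ {x} cx → ∈-deduplicate⁺ S _≈?_ (λ p q → DecSetoid.trans DS q (DecSetoid.sym DS p))
      (∈-filter⁺ S coloured? resp (all∈ x) cx))
    (λ x∈ → proj₂ (∈-filter⁻ S coloured? resp {xs = xs} (∈-deduplicate⁻ S _≈?_ _ x∈)))
    where
    coloured? = λ x → Func.to c x ≟ i
    resp : ∀ {x y} → x ≈ y → Func.to c x ≡ i → Func.to c y ≡ i
    resp x≈y = trans (sym (Func.cong c x≈y))

  side : ∀ {P : Set} → Dec P → Fin 2
  side (yes _) = zero
  side (no  _) = suc zero

  side-yes : ∀ {P : Set} (P? : Dec P) → P → side P? ≡ zero
  side-yes (yes _) _ = refl
  side-yes (no ¬p) p = ⊥-elim (¬p p)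

  side-zero : ∀ {P : Set} (P? : Dec P) → side P? ≡ zero → P
  side-zero (yes p) _ = p

  side-⇔ : ∀ {P Q : Set} (P? : Dec P) (Q? : Dec Q) → (P → Q) → (Q → P) → side P? ≡ side Q?
  side-⇔ (yes p) Q?      pq qp = sym (side-yes Q? (pq p))
  side-⇔ (no ¬p) (yes q) pq qp = ⊥-elim (¬p (qp q))
  side-⇔ (no ¬p) (no ¬q) pq qp = refl

  indicator : List A → Colouring S 2
  indicator ys = record
    { to   = λ x → side (x ∈? ys)
    ; cong = λ {x} {y} x≈y → side-⇔ (x ∈? ys) (y ∈? ys)
        (∈-resp-≈ S x≈y) (∈-resp-≈ S (DecSetoid.sym DS x≈y))
    }

  -- No bound on the complementary class is needed: it is itself a class of a
  -- distinguishing colouring, so the lower bound applies to it.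
  isCost : (∃[ xs ] (∀ x → x ∈ xs)) →
           ∀ {ys} → Unique ys →
           (∀ φ → (∀ {x} → x ∈ ys → (φ · x) ∈ ys) → IsIdentity φ) →
           (∀ (c : Colouring S 2) i {a} → IsDistinguishing c → HasSize (ColourClass c i) a → length ys ≤ a) →
           A → ∃[ φ ] ¬ IsIdentity φ →
           IsCost (length ys)
  isCost finite {ys} u rigid bound x₀ (φ , φ≢id) =
    ((c , distinguishing) , at-least-two) ,
    ( c , distinguishing , length ys , _ , zero-class , proj₂ one-class
    , sym (m≤n⇒m⊓n≡m (bound c (suc zero) distinguishing (proj₂ one-class)))) ,
    λ { _ (c′ , dist , _ , _ , size₀ , size₁ , refl) →
        ⊓-glb (bound c′ zero dist size₀) (bound c′ (suc zero) dist size₁) }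
    where
    c = indicator ys

    distinguishing : IsDistinguishing c
    distinguishing φ pres = rigid φ λ {x} x∈ →
      side-zero (_ ∈? ys) (trans (pres x) (side-yes (x ∈? ys) x∈))

    zero-class : HasSize (ColourClass c zero) (length ys)
    zero-class = class-size c zero u (λ {x} → side-zero (x ∈? ys)) (λ {x} → side-yes (x ∈? ys))

    one-class : ∃[ m ] HasSize (ColourClass c (suc zero)) m
    one-class = class-finite finite c (suc zero)

    Fin1-unique : (i j : Fin 1) → i ≡ j
    Fin1-unique zero zero = refl

    -- The element `x₀` cannot be coloured with no colours, and a single colour is preserved by the
    -- nontrivial `φ`.
    at-least-two : ∀ r → ∃[ c ] IsDistinguishing {r} c → 2 ≤ r
    at-least-two zero          (c , _)    with () ← Func.to c x₀
    at-least-two (suc zero)    (c , dist) = ⊥-elim (φ≢id (dist φ λ _ → Fin1-unique _ _))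
    at-least-two (suc (suc r)) _          = s≤s (s≤s z≤n)

  -- If an involution maps a class into itself, no element outside can enter the class, and with two
  -- colours being outside means having the other colour.
  involution-preserves : ∀ {φ} → (∀ x → (φ · (φ · x)) ≈ x) → (c : Colouring S 2) (i : Fin 2) →
                         (∀ x → Func.to c x ≡ i → Func.to c (φ · x) ≡ i) → Preserves φ c
  involution-preserves {φ} inv c i closed x with Func.to c x ≟ i | Func.to c (φ · x) ≟ i
  ... | yes cx | _       = trans (closed x cx) (sym cx)
  ... | no ¬cx | yes cφx = ⊥-elim (¬cx (trans (Func.cong c (DecSetoid.sym DS (inv x))) (closed _ cφx)))
  ... | no ¬cx | no ¬cφx = others-agree ¬cφx ¬cx
    where
    others-agree : ∀ {i j k : Fin 2} → j ≢ i → k ≢ i → j ≡ k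
    others-agree {_}        {zero}     {zero}     _ _ = refl
    others-agree {_}        {suc zero} {suc zero} _ _ = refl
    others-agree {zero}     {zero}     {suc zero} p _ = ⊥-elim (p refl)
    others-agree {suc zero} {zero}     {suc zero} _ q = ⊥-elim (q refl)
    others-agree {zero}     {suc zero} {zero}     _ q = ⊥-elim (q refl)
    others-agree {suc zero} {suc zero} {zero}     p _ = ⊥-elim (p refl)

-- Lower bounds

-- Being an involution, the automorphism also takes `v` to `u`; for `u = v` it is a nontrivial
-- automorphism fixing `u`.
Exchange : (G : Graph) → V G → V G → Set
Exchange G u v = Σ[ φ ∈ Automorphism G ]
  (∀ x → Automorphism.to φ (Automorphism.to φ x) ≡ x) × Automorphism.to φ u ≡ v × ¬ IsIdentity φ

exchange-□ : ∀ {G H} → (∀ u v → Exchange G u v) → (∀ u v → Exchange H u v) →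
             ∀ u v → Exchange (G □ H) u v
exchange-□ {G} {H} exG exH (u , u′) (v , v′) with exG u v | exH u′ v′
... | φ , φφ , φu , φ≢id | ψ , ψψ , ψu , _ = χ
  , (λ (x , y) → cong₂ _,_ (φφ x) (ψψ y))
  , cong₂ _,_ φu ψu
  , λ χ-id → φ≢id λ x → cong proj₁ (χ-id (x , u′))
  where
  module φ = Automorphism φ
  module ψ = Automorphism ψ
  χ : Automorphism (G □ H)
  χ = record
    { perm = mk↔ₛ′ (λ (x , y) → φ.to x , ψ.to y) (λ (x , y) → φ.to x , ψ.to y)
        (λ (x , y) → cong₂ _,_ (φφ x) (ψψ y)) (λ (x , y) → cong₂ _,_ (φφ x) (ψψ y))
    ; adj  = λ (x , y) (x′ , y′) → mk⇔
        (λ { (inj₁ (p , q)) → inj₁ (cong φ.to p , Equivalence.to (ψ.adj y y′) q)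
           ; (inj₂ (p , q)) → inj₂ (Equivalence.to (φ.adj x x′) p , cong ψ.to q) })
        (λ { (inj₁ (p , q)) → inj₁ (trans (sym (φφ x)) (trans (cong φ.to p) (φφ x′)) , Equivalence.from (ψ.adj y y′) q)
           ; (inj₂ (p , q)) → inj₂ (Equivalence.from (φ.adj x x′) p , trans (sym (ψψ y)) (trans (cong ψ.to q) (ψψ y′))) })
    }

exchange-cycle : ∀ {n} (3≤n : 3 ≤ suc n) → ∀ u v → Exchange (cycle (suc n) 3≤n) u v
exchange-cycle {n} 3≤n u v with reflection u v
-- If `f` were the identity, `next u` and `prev u` would coincide, so two steps would close up on a
-- cycle of at least three vertices.
... | f , D , ff , fu = φ , ff , fu , λ f-id → fold-next-fixed (s≤s⁻¹ 3≤n) u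
  (trans (cong next (trans (sym (f-id (next u))) (trans (D Sign.+ u) (cong prev (f-id u))))) (next-prev u))
  where
  open Torus 3≤n using (C; ~⇒∼; ~-turn)
  preserves : ∀ {x y} → _~_ C x y → _~_ C (f x) (f y)
  preserves {x} x~y with s , refl ← ~⇒∼ x~y = subst (_~_ C (f x)) (sym (D s x)) (~-turn (s Sign.* Sign.-) (f x))
  φ : Automorphism C
  φ = record
    { perm = mk↔ₛ′ f f ff ff
    ; adj  = λ x y → mk⇔ preserves (λ p → subst₂ (_~_ C) (ff x) (ff y) (preserves p))
    }

exchange-power : ∀ {G} → (∀ u v → Exchange G u v) → ∀ k u v → Exchange (G ^ suc k) u v
exchange-power ex zero    = ex
exchange-power ex (suc k) = exchange-□ ex (exchange-power ex k)

-- Enumeration of vertices and edges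

record FiniteGraph (G : Graph) : Set where
  field
    _≟ⱽ_     : DecidableEquality (V G)
    _~?_     : Decidable₂ (_~_ G)
    vertices : List (V G)
    complete : ∀ v → v ∈-Prop.∈ vertices

finite-□ : ∀ {G H} → FiniteGraph G → FiniteGraph H → FiniteGraph (G □ H)
finite-□ F K = record
  { _≟ⱽ_     = ≡-dec F._≟ⱽ_ K._≟ⱽ_
  ; _~?_     = λ (x , y) (x′ , y′) → ((x F.≟ⱽ x′) ×-dec (y K.~? y′)) ⊎-dec ((x F.~? x′) ×-dec (y K.≟ⱽ y′))
  ; vertices = cartesianProduct F.vertices K.vertices
  ; complete = λ (x , y) → ∈-cartesianProduct⁺ (F.complete x) (K.complete y)
  }
  where
  module F = FiniteGraph F
  module K = FiniteGraph K

finite-cycle : ∀ {n} (3≤n : 3 ≤ n) → FiniteGraph (cycle n 3≤n)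
finite-cycle {n} _ = record
  { _≟ⱽ_     = _≟_
  ; _~?_     = λ i j → next? i j ⊎-dec next? j i
  ; vertices = allFin n
  ; complete = ∈-allFin
  }
  where
  next? : Decidable₂ (Next {n})
  next? i j = (suc (toℕ i) ≟ᴺ toℕ j) ⊎-dec ((suc (toℕ i) ≟ᴺ n) ×-dec (toℕ j ≟ᴺ 0))

finite-power : ∀ {G} → FiniteGraph G → ∀ k → FiniteGraph (G ^ suc k)
finite-power F zero    = F
finite-power F (suc k) = finite-□ F (finite-power F k)

module _ {G : Graph} (F : FiniteGraph G) where
  open FiniteGraph F

  VertexDS : DecSetoid 0ℓ 0ℓ
  VertexDS = ≡.decSetoid _≟ⱽ_

  EdgeDS : DecSetoid 0ℓ 0ℓ
  EdgeDS = record
    { isDecEquivalence = record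
      { isEquivalence = Setoid.isEquivalence (Edges G)
      ; _≟_ = λ (u , v , _) (u′ , v′ , _) →
          ((u ≟ⱽ u′) ×-dec (v ≟ⱽ v′)) ⊎-dec ((u ≟ⱽ v′) ×-dec (v ≟ⱽ u′))
      } }

  open ∈-DecSetoid EdgeDS using () renaming (_∈_ to _∈ᴱ_)

  -- Every edge is listed in both orientations; the repetition is harmless because `class-finite`
  -- removes duplicates.
  edges : ∃[ es ] (∀ e → e ∈ᴱ es)
  edges = among pairs , λ (u , v , e) → found (∈-cartesianProduct⁺ (complete u) (complete v)) e
    where
    pairs = cartesianProduct vertices vertices
    among : List (V G × V G) → List (Setoid.Carrier (Edges G))
    among []             = []
    among ((u , v) ∷ ps) with u ~? v
    ... | yes e = (u , v , e) ∷ among ps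
    ... | no  _ = among ps
    found : ∀ {u v ps} → (u , v) ∈-Prop.∈ ps → (e : _~_ G u v) → (u , v , e) ∈ᴱ among ps
    found {u} {v} (here refl) e with u ~? v
    ... | yes _ = here (inj₁ (refl , refl))
    ... | no ¬e = ⊥-elim (¬e e)
    found {ps = (u′ , v′) ∷ _} (there p) e with u′ ~? v′
    ... | yes _ = there (found p e)
    ... | no  _ = found p e

  module VC = Cost G VertexDS (onVertices {G})
  module EC = Cost G EdgeDS (onEdges {G})

  -- Lower bounds on the colour classes

  module _ (exchange : ∀ u v → Exchange G u v) where

    -- A class consisting of `u` and `v` would be preserved by their exchange. The empty class and a
    -- singleton fall under the same argument with `u = v`.
    vertex-bound : V G → ∀ (c : Colouring (Vertices G) 2) i {a} →
                   VertexDistinguishing.IsDistinguishing G c → HasSize (ColourClass c i) a → 3 ≤ a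
    vertex-bound x₀ c i {a} dist size = go a size
      where
      -- `covered` lets the class be empty or consist of `u` and `v`: a vertex of the class is one
      -- of the two, and the other also has colour `i`.
      contradiction : ∀ u v → (∀ x → Func.to c x ≡ i → (x ≡ u × Func.to c v ≡ i) ⊎ (x ≡ v × Func.to c u ≡ i)) →
                      ∀ {P : Set} → P
      contradiction u v covered with exchange u v
      ... | φ , φφ , φu , φ≢id = ⊥-elim (φ≢id (dist φ (VC.involution-preserves {φ} φφ c i closed)))
        where
        closed : ∀ x → Func.to c x ≡ i → Func.to c (Automorphism.to φ x) ≡ i
        closed x cx with covered x cx
        ... | inj₁ (refl , cv) = trans (cong (Func.to c) φu) cv
        ... | inj₂ (refl , cu) = trans (cong (Func.to c) (trans (cong (Automorphism.to φ) (sym φu)) (φφ u))) cu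

      go : ∀ a → HasSize (ColourClass c i) a → 3 ≤ a
      go 0 size = contradiction x₀ x₀ λ x cx → ⊥-elim (empty (Inverse.from size (x , cx)))
        where
        empty : ¬ Fin 0
        empty ()
      go 1 size = contradiction u u λ x cx →
        inj₁ (located (Inverse.from size (x , cx)) (Inverse.strictlyInverseˡ size (x , cx)) , proj₂ (Inverse.to size zero))
        where
        u = proj₁ (Inverse.to size zero)
        located : ∀ {x} j → proj₁ (Inverse.to size j) ≡ x → x ≡ u
        located zero = sym
      go 2 size = contradiction u v λ x cx →
        located (Inverse.from size (x , cx)) (Inverse.strictlyInverseˡ size (x , cx))
        where
        u = proj₁ (Inverse.to size zero)
        v = proj₁ (Inverse.to size (suc zero))
        located : ∀ {x} j → proj₁ (Inverse.to size j) ≡ x → (x ≡ u × Func.to c v ≡ i) ⊎ (x ≡ v × Func.to c u ≡ i)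
        located zero       e = inj₁ (sym e , proj₂ (Inverse.to size (suc zero)))
        located (suc zero) e = inj₂ (sym e , proj₂ (Inverse.to size zero))
      go (suc (suc (suc a))) _ = s≤s (s≤s (s≤s z≤n))

    -- Exchanging the ends of an edge reverses it, and an edge and its reverse are equal in
    -- `Edges G`. So a class with at most one edge is preserved by a nontrivial automorphism.
    edge-bound : Setoid.Carrier (Edges G) → ∀ (c : Colouring (Edges G) 2) i {a} →
                 EdgeDistinguishing.IsDistinguishing G c → HasSize (ColourClass c i) a → 2 ≤ a
    edge-bound e₀ c i {a} dist size = go a size
      where
      open Setoid (Edges G) using (_≈_) renaming (Carrier to E; sym to ≈-sym)

      contradiction : (e : E) → (∀ x → Func.to c x ≡ i → x ≈ e) → ∀ {P : Set} → P
      contradiction (u , v , e) covered with exchange u v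
      ... | φ , φφ , φu , φ≢id = ⊥-elim (φ≢id (dist φ (EC.involution-preserves {φ}
          (λ (x , y , _) → inj₁ (φφ x , φφ y)) c i
          (λ x cx → trans (Func.cong c {onEdges φ x} {x} (fixed x (covered x cx))) cx))))
        where
        φv : Automorphism.to φ v ≡ u
        φv = trans (cong (Automorphism.to φ) (sym φu)) (φφ u)
        fixed : ∀ x → x ≈ (u , v , e) → onEdges φ x ≈ x
        fixed _ (inj₁ (refl , refl)) = inj₂ (φu , φv)
        fixed _ (inj₂ (refl , refl)) = inj₂ (φv , φu)

      go : ∀ a → HasSize (ColourClass c i) a → 2 ≤ a
      go 0 size = contradiction e₀ λ x cx → ⊥-elim (empty (Inverse.from size (x , cx)))
        where
        empty : ¬ Fin 0
        empty ()
      go 1 size = contradiction (proj₁ (Inverse.to size zero)) λ x cx →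
        located {x} (Inverse.from size (x , cx)) (Inverse.strictlyInverseˡ size (x , cx))
        where
        located : ∀ {x} j → proj₁ (Inverse.to size j) ≈ x → x ≈ proj₁ (Inverse.to size zero)
        located {x} zero = ≈-sym {proj₁ (Inverse.to size zero)} {x}
      go (suc (suc a)) _ = s≤s (s≤s z≤n)

-- Sets of three vertices and of two edges with trivial stabiliser

module Witnesses {n : ℕ} (4≤n : 4 ≤ n) (3≤n : 3 ≤ suc n) where
  open Torus 3≤n

  exchange : ∀ k u v → Exchange (C ^ suc k) u v
  exchange = exchange-power (exchange-cycle 3≤n)

  finite : ∀ k → FiniteGraph (C ^ suc k)
  finite = finite-power (finite-cycle 3≤n)

  private
    2≤n : 2 ≤ n
    2≤n = ≤-trans (m≤m+n 2 2) 4≤n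

    3≤n′ : 3 ≤ n
    3≤n′ = ≤-trans (m≤m+n 3 1) 4≤n

  -- Three vertices with trivial stabiliser

  module ThreeVertices {k} (j : Fin (suc k) → Fin (suc n))
    (j-injective : ∀ {i l} → j i ≡ j l → i ≡ l)
    {i₀ i₁ i₂ : Fin (suc k)}
    -- These two keep `c` from being adjacent to `a` or `b` in all coordinates; `unflipped` excludes
    -- a swap of `a` and `b`, under which `f i₂` would be the reflection exchanging 0 and 1.
    (0≁j : ¬ zero ∼ j i₀) (1≁j : ¬ # 1 ∼ j i₁)
    (unflipped : ∀ {g} → Dihedral Sign.- g → g zero ≡ # 1 → ∀ l → g (j i₂) ≢ j l) where

    a b c : X k
    a = tabulate k (λ _ → zero)
    b = tabulate k (λ _ → # 1)
    c = tabulate k j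

    a-coord : ∀ i → coord k a i ≡ zero
    a-coord = coord-tabulate k _

    b-coord : ∀ i → coord k b i ≡ # 1
    b-coord = coord-tabulate k _

    c-coord : ∀ i → coord k c i ≡ j i
    c-coord = coord-tabulate k j

    -- Adjacency in the tensor power of the cycle. Automorphisms preserve it because they permute
    -- the coordinates and act on each by a dihedral map.
    Near : X k → X k → Set
    Near x y = ∀ i → coord k x i ∼ coord k y i

    near-sym : ∀ x y → Near x y → Near y x
    near-sym x y x∼y i = ∼-sym (x∼y i)

    near-irrefl : ∀ x → ¬ Near x x
    near-irrefl x x∼x with s , e ← x∼x zero = turn-fixed (<⇒≤ 2≤n) s _ (sym e)

    near-ab : Near a b
    near-ab i = Sign.+ , trans (b-coord i) (cong next (sym (a-coord i)))

    ¬near-ac : ¬ Near a c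
    ¬near-ac p = 0≁j (subst₂ _∼_ (a-coord i₀) (c-coord i₀) (p i₀))

    ¬near-bc : ¬ Near b c
    ¬near-bc p = 1≁j (subst₂ _∼_ (b-coord i₁) (c-coord i₁) (p i₁))

    a≢b : a ≢ b
    a≢b e = near-irrefl a (subst (Near a) (sym e) near-ab)

    a≢c : a ≢ c
    a≢c e = ¬near-bc (near-sym c b (subst (λ x → Near x b) e near-ab))

    b≢c : b ≢ c
    b≢c e = ¬near-ac (subst (Near a) e near-ab)

    ys : List (X k)
    ys = a ∷ b ∷ c ∷ []

    near-pair : ∀ {x y} → x ∈-Prop.∈ ys → y ∈-Prop.∈ ys → Near x y → (x ≡ a × y ≡ b) ⊎ (x ≡ b × y ≡ a)
    near-pair (here refl)                 (here refl)                 p = ⊥-elim (near-irrefl a p)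
    near-pair (here refl)                 (there (here refl))         p = inj₁ (refl , refl)
    near-pair (here refl)                 (there (there (here refl))) p = ⊥-elim (¬near-ac p)
    near-pair (there (here refl))         (here refl)                 p = inj₂ (refl , refl)
    near-pair (there (here refl))         (there (here refl))         p = ⊥-elim (near-irrefl b p)
    near-pair (there (here refl))         (there (there (here refl))) p = ⊥-elim (¬near-bc p)
    near-pair (there (there (here refl))) (here refl)                 p = ⊥-elim (¬near-ac (near-sym c a p))
    near-pair (there (there (here refl))) (there (here refl))         p = ⊥-elim (¬near-bc (near-sym c b p))
    near-pair (there (there (here refl))) (there (there (here refl))) p = ⊥-elim (near-irrefl c p)

    rigid : ∀ (φ : Automorphism (C ^ suc k)) →
            (∀ {x} → x ∈-Prop.∈ ys → Automorphism.to φ x ∈-Prop.∈ ys) → IsIdentity φ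
    rigid φ stable = [ fixed , flipped ]′
      (near-pair (stable (here refl)) (stable (there (here refl))) (near-to a b near-ab))
      where
      open Automorphism φ
      open Classification 4≤n {k} φ

      near-to : ∀ x y → Near x y → Near (to x) (to y)
      near-to x y x∼y l with i , refl ← π-surjective l =
        subst₂ _∼_ (sym (coord-to x i)) (sym (coord-to y i)) (dihedral-∼ (f-dihedral i) (x∼y i))

      to-c : (to a ≡ a × to b ≡ b) ⊎ (to a ≡ b × to b ≡ a) → to c ≡ c
      to-c p with stable (there (there (here refl))) | p
      ... | here e                 | inj₁ (ea , _) = ⊥-elim (a≢c (to-injective (trans ea (sym e))))
      ... | here e                 | inj₂ (_ , eb) = ⊥-elim (b≢c (to-injective (trans eb (sym e))))
      ... | there (here e)         | inj₁ (_ , eb) = ⊥-elim (b≢c (to-injective (trans eb (sym e))))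
      ... | there (here e)         | inj₂ (ea , _) = ⊥-elim (a≢c (to-injective (trans ea (sym e))))
      ... | there (there (here e)) | _             = e

      f-j : to c ≡ c → ∀ i → f i (j i) ≡ j (π i)
      f-j ec i = f-at c i ec (c-coord i) (c-coord (π i))

      fixed : to a ≡ a × to b ≡ b → IsIdentity φ
      fixed p@(ea , eb) = isIdentity (λ i → sym (j-injective (trans (sym (f-id i (j i))) (f-j (to-c (inj₁ p)) i)))) f-id
        where
        f-id : ∀ i y → f i y ≡ y
        -- `f i` fixes 0 and 1, while the reflection fixing 0 sends 1 to the last vertex.
        f-id i = dihedral-fixing (f-dihedral i)
          (f-at a i ea (a-coord i) (a-coord (π i))) 0 1
          (f-at b i eb (b-coord i) (b-coord (π i))) 2≤n

      flipped : to a ≡ b × to b ≡ a → IsIdentity φ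
      flipped p@(ea , eb) = ⊥-elim (unflipped (subst (λ s → Dihedral s (f i₂)) reversed (f-dihedral i₂))
        f₀ (π i₂) (f-j (to-c (inj₂ p)) i₂))
        where
        f₀ : f i₂ zero ≡ # 1
        f₀ = f-at a i₂ ea (a-coord i₂) (b-coord (π i₂))
        f₁ : f i₂ (# 1) ≡ zero
        f₁ = f-at b i₂ eb (b-coord i₂) (a-coord (π i₂))
        reversed : sign i₂ ≡ Sign.-
        reversed = turn-injectiveˡ 2≤n _ _ (# 1) (trans (cong (turn (sign i₂)) (sym f₀))
          (trans (sym (f-dihedral i₂ Sign.+ zero)) (trans f₁ (sym (prev-next zero)))))

    cost : ρ[ C ^ suc k ]≡ 3
    cost = VC.isCost (finite k) (FiniteGraph.vertices (finite k) , FiniteGraph.complete (finite k))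
      ((a≢b ∷ a≢c ∷ []) ∷ (b≢c ∷ []) ∷ [] ∷ [])
      rigid
      (λ c i → vertex-bound (finite k) (exchange k) a c i)
      a (proj₁ (exchange k a a) , proj₂ (proj₂ (proj₂ (exchange k a a))))

  -- The neighbours of 0 are 1 and `n`, and the bound keeps `2 + m` strictly between them.
  0≁# : ∀ m → 3 + m ≤ n → ¬ zero ∼ # {n} (2 + m)
  0≁# m le (Sign.+ , e) with () ← fold-next-injective (<⇒≤ le) (<⇒≤ 2≤n) zero e
  0≁# m le (Sign.- , e) = fold-next-fixed le zero (trans (cong next e) (next-prev zero))

  1≁#3 : ¬ # {n} 1 ∼ # 3
  1≁#3 (Sign.+ , e) with () ← fold-next-injective 3≤n′ 2≤n zero e
  1≁#3 (Sign.- , e) = fold-next-fixed 3≤n′ zero (trans e (prev-next zero))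

  -- The reflection is `x ↦ 1 − x`, so `l = 1 − (m + 1)` modulo the length.
  flip-sum : ∀ {g : Fin (suc n) → Fin (suc n)} → Dihedral Sign.- g → g zero ≡ # 1 → ∀ m l → g (# (suc m)) ≡ # l → # (m + l) ≡ zero
  flip-sum {g} D g₀ m l e = next-injective (begin
    # (suc m + l)                               ≡⟨ fold-+ zero next (suc m) ⟩
    fold (# l) next (suc m)                     ≡⟨ cong (λ y → fold y next (suc m)) e ⟨
    fold (g (# (suc m))) next (suc m)           ≡⟨ cong (λ y → fold y next (suc m)) (dihedral-fold D zero (suc m)) ⟩
    fold (fold (g zero) prev (suc m)) next (suc m) ≡⟨ fold-prev-next (g zero) (suc m) ⟩
    g zero                                      ≡⟨ g₀ ⟩
    # 1                                         ∎)
    where open ≡-Reasoning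

  -- The third vertex cannot be 2, a neighbour of 1. The reflection `x ↦ 1 − x` sends 3 to `−2`,
  -- which equals 3 only modulo 5.
  three-vertices-cycle : 5 ≤ n → ρ[ C ]≡ 3
  three-vertices-cycle 5≤n = ThreeVertices.cost {0} (λ _ → # 3)
    (λ { {zero} {zero} _ → refl }) {zero} {zero} {zero} (0≁# 1 4≤n) 1≁#3
    (λ D g₀ _ e → fold-next-fixed 5≤n zero (flip-sum D g₀ 2 3 e))

  -- The first entry 2 is not a neighbour of 0, and the second entry 3 is not a neighbour of 1.
  -- Under `x ↦ 1 − x` the entry 2 goes to `−1 = n`, and all entries are below `n`.
  three-vertices-power : ∀ k → 4 + k ≤ n → ρ[ C ^ (2 + k) ]≡ 3
  three-vertices-power k le = ThreeVertices.cost {suc k} (λ i → # (2 + toℕ i))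
    (λ {i} {l} e → toℕ-injective (+-cancelˡ-≡ 2 _ _ (fold-next-injective (<⇒≤ (bound i)) (<⇒≤ (bound l)) zero e)))
    {zero} {suc zero} {zero} (0≁# 0 3≤n′) 1≁#3
    (λ D g₀ l e → fold-next-fixed (bound l) zero (flip-sum D g₀ 1 (2 + toℕ l) e))
    where
    bound : ∀ (i : Fin (2 + k)) → 3 + toℕ i ≤ n
    bound i = ≤-trans (+-monoʳ-≤ 2 (toℕ<n i)) le

  -- Two edges with trivial stabiliser

  module TwoEdges (k : ℕ) (2k≤n : k + k ≤ n) where

    -- The entries from coordinate 2 on are `1, …, k`. Since `k + k ≤ n`, two of them never add up
    -- to a multiple of the length, so a reflection fixing 0 cannot send one to another or to
    -- itself.
    j : Fin (2 + k) → Fin (suc n)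
    j zero          = zero
    j (suc zero)    = # 1
    j (suc (suc i)) = # (suc (toℕ i))

    K = suc k

    a b c d : X K
    a = tabulate K (λ _ → zero)
    b = step K (zero , Sign.+) a
    c = tabulate K j
    d = step K (suc zero , Sign.+) c

    ab cd : Setoid.Carrier (Edges (C ^ suc K))
    ab = a , b , ~-step K (zero , Sign.+) a
    cd = c , d , ~-step K (suc zero , Sign.+) c

    a-coord : ∀ i → coord K a i ≡ zero
    a-coord = coord-tabulate K (λ _ → zero)

    b-coord : ∀ i → coord K b (suc i) ≡ zero
    b-coord i = a-coord (suc i)

    c-coord : ∀ i → coord K c i ≡ j i
    c-coord = coord-tabulate K j

    d-coord₁ : coord K d (suc zero) ≡ # 2
    d-coord₁ = trans (coord-step K (suc zero) Sign.+ c) (cong next (c-coord (suc zero)))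

    #≢0 : ∀ {m} → suc m ≤ n → # (suc m) ≢ zero
    #≢0 le = fold-next-fixed le zero

    a≢c : a ≢ c
    a≢c e = #≢0 (<⇒≤ 2≤n) (trans (sym (c-coord (suc zero)))
      (trans (cong (λ x → coord K x (suc zero)) (sym e)) (a-coord (suc zero))))

    a≢d : a ≢ d
    a≢d e = #≢0 2≤n (trans (sym d-coord₁)
      (trans (cong (λ x → coord K x (suc zero)) (sym e)) (a-coord (suc zero))))

    open ∈-DecSetoid (EdgeDS (finite K)) using (_∈_)

    rigid : ∀ (φ : Automorphism (C ^ suc K)) →
            (∀ {x} → x ∈ ab ∷ cd ∷ [] → onEdges φ x ∈ ab ∷ cd ∷ []) → IsIdentity φ
    rigid φ stable = cases (stable {ab} (here (inj₁ (refl , refl)))) (stable {cd} (there (here (inj₁ (refl , refl)))))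
      where
      open Automorphism φ
      open Classification 4≤n {K} φ

      Onto : X K → X K → X K → X K → Set
      Onto x y x′ y′ = (to x ≡ x′ × to y ≡ y′) ⊎ (to x ≡ y′ × to y ≡ x′)

      direction : ∀ i x i′ x′ → Onto x (step K (i , Sign.+) x) x′ (step K (i′ , Sign.+) x′) → π i ≡ i′
      direction i x i′ x′ (inj₁ (refl , ey)) =
        cong proj₁ (step-injective 2≤n K (π i , sign i) (i′ , Sign.+) x′ (trans (sym (to-step⁺ i x)) ey))
      direction i x i′ x′ (inj₂ (ex , ey)) =
        cong proj₁ (step-injective 2≤n K (π i , sign i) (i′ , Sign.-) (to x)
          (trans (sym (to-step⁺ i x)) (trans ey (sym (trans (cong (step K (i′ , Sign.-)) ex)
            (step-neg K (i′ , Sign.+) x′))))))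

      coord-onto : ∀ {x y x′ y′} l {p} → Onto x y x′ y′ → coord K x′ l ≡ p → coord K y′ l ≡ p → coord K (to x) l ≡ p
      coord-onto l (inj₁ (refl , _)) ep eq = ep
      coord-onto l (inj₂ (refl , _)) ep eq = eq

      f₀-zero : ∀ x {y x′ y′} l → Onto x y x′ y′ → coord K x zero ≡ zero → π zero ≡ l →
                coord K x′ l ≡ zero → coord K y′ l ≡ zero → f zero zero ≡ zero
      f₀-zero x l o x₀ refl ep eq = f-at x zero refl x₀ (coord-onto (π zero) o ep eq)

      swapped : Onto a b c d → Onto c d a b → IsIdentity φ
      swapped ab→cd cd→ab = ⊥-elim (
        [ (λ (e , _) → #≢0 (<⇒≤ 2≤n) (trans (sym (c-coord (suc zero))) (absurd e)))
        , (λ (e , _) → #≢0 2≤n (trans (sym d-coord₁) (absurd e)))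
        ]′ ab→cd)
        where
        π₀ = direction zero a (suc zero) c ab→cd
        -- `π` sends coordinate 0 to 1. The vertex `c` has first entry 0 and lands on an end of
        -- `ab`, with 0 in coordinate 1, so `f zero` fixes 0. Then the image of `a` has 0 in
        -- coordinate 1, unlike `c` and `d`.
        absurd : ∀ {x} → to a ≡ x → coord K x (suc zero) ≡ zero
        absurd {x} e = begin
          coord K x (suc zero)     ≡⟨ cong (coord K x) π₀ ⟨
          coord K x (π zero)       ≡⟨ cong (λ y → coord K y (π zero)) e ⟨
          coord K (to a) (π zero)  ≡⟨ coord-to a zero ⟩
          f zero zero              ≡⟨ f₀-zero c (suc zero) cd→ab refl π₀ (a-coord (suc zero)) (b-coord zero) ⟩
          zero                     ∎
          where open ≡-Reasoning

      fixed : Onto a b a b → Onto c d c d → IsIdentity φ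
      -- Reversing `ab` would make `f zero` send 0 to 1, but both ends of `cd` are 0 in coordinate
      -- 0, so `f zero` fixes 0.
      fixed (inj₂ (ea , eb)) cd→cd = ⊥-elim (#≢0 (<⇒≤ 2≤n)
        (trans (sym (f-at a zero ea refl (cong (coord K b) π₀))) (f₀-zero c zero cd→cd refl π₀ refl refl)))
        where π₀ = direction zero a zero a (inj₂ (ea , eb))
      fixed (inj₁ (ea , eb)) cd→cd = isIdentity π-id f-id
        where
        π₀ : π zero ≡ zero
        π₀ = direction zero a zero a (inj₁ (ea , eb))

        π₁ : π (suc zero) ≡ suc zero
        π₁ = direction (suc zero) c (suc zero) c cd→cd

        f-zero : ∀ i → f i zero ≡ zero
        f-zero i = f-at a i ea (a-coord i) (a-coord (π i))

        f₁-at : ∀ {x} → to c ≡ x → f (suc zero) (# 1) ≡ coord K x (suc zero)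
        f₁-at {x} e = f-at c (suc zero) e (c-coord (suc zero)) (cong (coord K x) π₁)

        -- If `cd` were reversed, `f (suc zero)` would fix 0 and send 1 to 2, which neither the
        -- identity nor the reflection fixing 0 does.
        to-c≢d : to c ≢ d
        to-c≢d e = #≢0 (<⇒≤ 2≤n) (next-injective (trans (sym f₁)
          (dihedral-fixing (f-dihedral (suc zero)) (f-zero (suc zero)) 0 2 f₁ 3≤n′ (# 1))))
          where
          f₁ : f (suc zero) (# 1) ≡ # 2
          f₁ = trans (f₁-at e) d-coord₁

        to-c : to c ≡ c
        to-c = [ proj₁ , ⊥-elim ∘ to-c≢d ∘ proj₁ ]′ cd→cd

        π-high : ∀ i → ∃[ l ] π (suc (suc i)) ≡ suc (suc l)
        π-high i with π (suc (suc i)) in eq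
        ... | zero        with () ← π-injective {suc (suc i)} {zero} (trans eq (sym π₀))
        ... | suc zero    with () ← π-injective {suc (suc i)} {suc zero} (trans eq (sym π₁))
        ... | suc (suc l) = l , refl

        f-high : ∀ i → f (suc (suc i)) (# (suc (toℕ i))) ≡ # (suc (toℕ (proj₁ (π-high i))))
        f-high i = f-at c (suc (suc i)) to-c (c-coord (suc (suc i)))
          (trans (cong (coord K c) (proj₂ (π-high i))) (c-coord (suc (suc (proj₁ (π-high i))))))

        f-id : ∀ i y → f i y ≡ y
        f-id zero          = dihedral-fixing (f-dihedral zero) (f-zero zero) 0 1
          (f-at b zero eb refl (cong (coord K b) π₀)) 2≤n
        f-id (suc zero)    = dihedral-fixing (f-dihedral (suc zero)) (f-zero (suc zero)) 0 1
          (trans (f₁-at to-c) (c-coord (suc zero))) 2≤n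
        f-id (suc (suc i)) = dihedral-fixing (f-dihedral (suc (suc i))) (f-zero (suc (suc i))) (toℕ i) _
          (f-high i) (≤-trans (+-mono-≤ (toℕ<n i) (toℕ<n (proj₁ (π-high i)))) 2k≤n)

        π-id : ∀ i → π i ≡ i
        π-id zero          = π₀
        π-id (suc zero)    = π₁
        π-id (suc (suc i)) = trans (proj₂ (π-high i)) (cong (λ l → suc (suc l))
          (toℕ-injective (suc-injective (fold-next-injective (bound (proj₁ (π-high i))) (bound i) zero
            (trans (sym (f-high i)) (f-id (suc (suc i)) _))))))
          where
          bound : ∀ (i : Fin k) → suc (toℕ i) ≤ n
          bound i = ≤-trans (toℕ<n i) (≤-trans (m≤m+n k k) 2k≤n)

      -- Two edges with the same image would make `π` take coordinates 0 and 1 to the same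
      -- coordinate.
      parallel : ∀ i x′ y′ → Onto a b x′ y′ → Onto c d x′ y′ → y′ ≡ step K (i , Sign.+) x′ → IsIdentity φ
      parallel i x′ _ p q refl with () ← π-injective {zero} {suc zero}
        (trans (direction zero a i x′ p) (sym (direction (suc zero) c i x′ q)))

      cases : onEdges φ ab ∈ ab ∷ cd ∷ [] → onEdges φ cd ∈ ab ∷ cd ∷ [] → IsIdentity φ
      cases (here p)         (there (here q)) = fixed p q
      cases (there (here p)) (here q)         = swapped p q
      cases (here p)         (here q)         = parallel zero a b p q refl
      cases (there (here p)) (there (here q)) = parallel (suc zero) c d p q refl

    cost : ρ′[ C ^ suc K ]≡ 2
    cost = EC.isCost (finite K) (edges (finite K))
      (([ a≢c ∘ proj₁ , a≢d ∘ proj₁ ]′ ∷ []) ∷ [] ∷ [])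
      rigid
      (λ c i → edge-bound (finite K) (exchange K) ab c i)
      ab (proj₁ (exchange K a a) , proj₂ (proj₂ (proj₂ (exchange K a a))))

-- The case `n = 5`, `t = 1` is excluded because the cost is undefined there: one of two colour
-- classes on five vertices has at most two members, and a reflection preserves it. So the
-- distinguishing number of the 5-cycle exceeds 2.
theorem5p3 : (n : ℕ) (5≤n : 5 ≤ n) (k t : ℕ) → 1 ≤ k → 1 ≤ t →
    let C = cycle n (≤-trans (m≤m+n 3 2) 5≤n) in
    (2 ≤ k → k ≤ 1 + ⌊ n /2⌋ → ρ′[ C ^ k ]≡ 2) ×
    (t ≤ ⌊ n /2⌋ → ¬ (n ≡ 5 × t ≡ 1) → ρ[ C ^ t ]≡ 3)
theorem5p3 (suc n) 5≤n k t _ 1≤t = edge-cost k , vertex-cost t 1≤t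
  where
  4≤n : 4 ≤ n
  4≤n = s≤s⁻¹ 5≤n

  3≤n : 3 ≤ suc n
  3≤n = ≤-trans (m≤m+n 3 2) 5≤n

  open Witnesses 4≤n 3≤n

  edge-cost : ∀ k → 2 ≤ k → k ≤ 1 + ⌊ suc n /2⌋ → ρ′[ cycle (suc n) 3≤n ^ k ]≡ 2
  -- Doubling `k + 1 ≤ ⌊ suc n /2⌋` gives `2k + 2 ≤ suc n`, hence `k + k ≤ n`.
  edge-cost (suc (suc k)) _ (s≤s k<⌊n/2⌋) = TwoEdges.cost k (≤-trans (+-monoʳ-≤ k (n≤1+n k)) (s≤s⁻¹ (begin
    suc k + suc k             ≤⟨ +-mono-≤ k<⌊n/2⌋ (≤-trans k<⌊n/2⌋ (⌊n/2⌋≤⌈n/2⌉ (suc n))) ⟩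
    ⌊ suc n /2⌋ + ⌈ suc n /2⌉ ≡⟨ ⌊n/2⌋+⌈n/2⌉≡n (suc n) ⟩
    suc n                     ∎)))
    where open ≤-Reasoning
  edge-cost (suc zero) (s≤s ()) _

  vertex-cost : ∀ t → 1 ≤ t → t ≤ ⌊ suc n /2⌋ → ¬ (suc n ≡ 5 × t ≡ 1) → ρ[ cycle (suc n) 3≤n ^ t ]≡ 3
  vertex-cost (suc zero)    _ _  n≢5 = three-vertices-cycle (≤∧≢⇒< 4≤n λ e → n≢5 (cong suc (sym e) , refl))
  -- The upper half of a number that is at least 5 is at least 3, so `t + 3 ≤ suc n` for
  -- `t = 2 + k`, which is `4 + k ≤ n`.
  vertex-cost (suc (suc k)) _ le _   = three-vertices-power k (s≤s⁻¹ (begin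
    5 + k                     ≡⟨ +-comm 3 (2 + k) ⟩
    2 + k + 3                 ≤⟨ +-mono-≤ le (⌊n/2⌋-mono (s≤s 5≤n)) ⟩
    ⌊ suc n /2⌋ + ⌈ suc n /2⌉ ≡⟨ ⌊n/2⌋+⌈n/2⌉≡n (suc n) ⟩
    suc n                     ∎))
    where open ≤-Reasoning
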